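{- Let $m$ and $m'$ be partial assignments and $f$ a formula. If $m$ contains no decision literals, $m'$ is a model of $f$, and $f$ entails $m$, then the concatenation $m'm$ is also a model of $f$.
   Context: Fix a finite set $P$ of atoms. A literal is an atom $p\in P$ or its negation $\neg p$, with $\neg\neg p=p$. A clause is a finite list of literals, read as their disjunction; a formula (CNF) is a finite list of clauses, read as their conjunction. A partial assignment is an arbitrary finite list of literals, each annotated either as a decision literal (written $l^d$) or as a propagated literal (written $l$). New literals are appended on the right, and $mn$ denotes concatenation. Evaluation takes values in $\{T,F,U\}$ and ignores annotations; the rightmost occurrence of an atom takes precedence: $[\![l]\!]_m=T$ if the rightmost occurrence in $m$ of the atom of $l$ is as $l$, $F$ if it is as $\neg l$, and $U$ if the atom does not occur in $m$. For a clause $c$: $[\![c]\!]_m=T$ if some literal of $c$ evaluates to $T$, $F$ if all literals of $c$ evaluate to $F$, else $U$. For a formula $f$: $[\![f]\!]_m=T$ if all clauses evaluate to $T$, $F$ if some clause evaluates to $F$, else $U$. A partial assignment $m$ is a model of (satisfies) $f$ if $[\![f]\!]_m=T$. A partial assignment $m'$ satisfies a partial assignment $m$ if every literal that is true in $m$ is true in $m'$. A literal $l$ is model-preserving in $f$ if for every partial assignment $m'$ satisfying $f$, the partial assignment $m'l$ satisfies $f$. Entailment is defined inductively: $f$ entails $m$ if one of the following holds. (1) Every model of $f$ satisfies $m$, and $m$ contains no decision literals. (2) $m=m'\,l^d\,n$, where every model of $f$ satisfying $m'\,l^d$ satisfies $n$, $n$ contains no decision literals, and $f$ entails $m'$. (3)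 $m=m'\,l\,n$ with $l$ a propagated literal, where $l$ is model-preserving in $f$, every model of $f$ satisfying $m'\,l$ satisfies $n$, $n$ contains no decision literals, and $f$ entails $m'$. -}

module Defs where

open import Data.Bool using (if_then_else_)
open import Data.Fin using (Fin; _≟_)
open import Data.List using (List; map; filter; last; _++_; _∷ʳ_)
open import Data.List.Relation.Unary.All using (all?)
open import Data.List.Relation.Unary.Any using (Any; any?)
open import Data.Maybe using (Maybe; maybe′)
open import Data.Nat using (ℕ)
open import Relation.Binary.Definitions using (DecidableEquality)
open import Relation.Binary.PropositionalEquality using (_≡_; refl; cong)
open import Relation.Nullary using (¬_; yes; no; does)
open import Relation.Nullary.Decidable using (map′)

private variable
  k : ℕ

-- The finite set of atoms is Fin k.

data Literal (k : ℕ) : Set where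
  pos neg : Fin k → Literal k

atom : Literal k → Fin k
atom (pos p) = p
atom (neg p) = p

infix 4 _≟ˡ_

_≟ˡ_ : DecidableEquality (Literal k)
pos p ≟ˡ pos q = map′ (cong pos) (λ { refl → refl }) (p ≟ q)
pos _ ≟ˡ neg _ = no λ ()
neg _ ≟ˡ pos _ = no λ ()
neg p ≟ˡ neg q = map′ (cong neg) (λ { refl → refl }) (p ≟ q)

Clause : ℕ → Set
Clause k = List (Literal k)

Formula : ℕ → Set
Formula k = List (Clause k)

data AnnotatedLiteral (k : ℕ) : Set where
  decision propagated : Literal k → AnnotatedLiteral k

literal : AnnotatedLiteral k → Literal k
literal (decision   l) = l
literal (propagated l) = l

PartialAssignment : ℕ → Set
PartialAssignment k = List (AnnotatedLiteral k)

data IsDecision {k} : AnnotatedLiteral k → Set where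
  decision : ∀ l → IsDecision (decision l)

NoDecisions : PartialAssignment k → Set
NoDecisions m = ¬ Any IsDecision m

data TruthValue : Set where
  T F U : TruthValue

infix 4 _≟ᵛ_

_≟ᵛ_ : DecidableEquality TruthValue
T ≟ᵛ T = yes refl
T ≟ᵛ F = no λ ()
T ≟ᵛ U = no λ ()
F ≟ᵛ T = no λ ()
F ≟ᵛ F = yes refl
F ≟ᵛ U = no λ ()
U ≟ᵛ T = no λ ()
U ≟ᵛ F = no λ ()
U ≟ᵛ U = yes refl

rightmost : Fin k → PartialAssignment k → Maybe (Literal k)
rightmost p m = last (filter (λ l → atom l ≟ p) (map literal m))

-- The rightmost occurrence has the same atom as l, so if it is not l
-- then it is the negation of l.
evalLiteral : PartialAssignment k → Literal k → TruthValue
evalLiteral m l =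
  maybe′ (λ l′ → if does (l′ ≟ˡ l) then T else F) U (rightmost (atom l) m)

evalClause : PartialAssignment k → Clause k → TruthValue
evalClause m c =
  if does (any? (λ l → evalLiteral m l ≟ᵛ T) c) then T else
  if does (all? (λ l → evalLiteral m l ≟ᵛ F) c) then F else U

evalFormula : PartialAssignment k → Formula k → TruthValue
evalFormula m f =
  if does (all? (λ c → evalClause m c ≟ᵛ T) f) then T else
  if does (any? (λ c → evalClause m c ≟ᵛ F) f) then F else U

infix 4 _IsModelOf_ _Satisfies_ _Entails_

_IsModelOf_ : PartialAssignment k → Formula k → Set
m IsModelOf f = evalFormula m f ≡ T

_Satisfies_ : PartialAssignment k → PartialAssignment k → Set
m′ Satisfies m = ∀ l → evalLiteral m l ≡ T → evalLiteral m′ l ≡ T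

-- Evaluation ignores annotations, so annotating the appended l as
-- propagated is immaterial.
ModelPreserving : Formula k → Literal k → Set
ModelPreserving f l =
  ∀ m′ → m′ IsModelOf f → (m′ ∷ʳ propagated l) IsModelOf f

data _Entails_ {k} (f : Formula k) : PartialAssignment k → Set where
  implied :
    ∀ m →
    (∀ M → M IsModelOf f → M Satisfies m) →
    NoDecisions m →
    f Entails m

  decided :
    ∀ m′ l n →
    (∀ M → M IsModelOf f → M Satisfies (m′ ∷ʳ decision l) → M Satisfies n) →
    NoDecisions n →
    f Entails m′ →
    f Entails ((m′ ∷ʳ decision l) ++ n)

  preserved :
    ∀ m′ l n →
    ModelPreserving f l →
    (∀ M → M IsModelOf f → M Satisfies (m′ ∷ʳ propagated l) → M Satisfies n) →
    NoDecisions n →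
    f Entails m′ →
    f Entails ((m′ ∷ʳ propagated l) ++ n)

{-# OPTIONS --safe #-}
-- If M satisfies n, then every literal that n sets is already true in M, so
-- appending n to M keeps every true literal true, and hence keeps M a model.
-- By induction on entailment this applies to each block of consequences in m,
-- and a model-preserving literal may be appended by definition.
module Submission where

open import Defs
open import Data.Bool using (if_then_else_)
open import Data.Fin using (Fin; _≟_)
open import Data.List using (List; []; _∷_; filter; last; map; _++_; _∷ʳ_)
open import Data.List.Properties using (++-assoc; filter-++; map-++)
import Data.List.Relation.Unary.All as All
open import Data.List.Relation.Unary.All using (all?)
open import Data.List.Relation.Unary.All.Properties using (all-filter; last⁺)
import Data.List.Relation.Unary.Any as Any
open import Data.List.Relation.Unary.Any using (here; any?)
open import Data.List.Relation.Unary.Any.Properties using (++⁺ˡ; ++⁺ʳ)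
open import Data.Maybe using (Maybe; just; nothing; _<∣>_)
import Data.Maybe.Relation.Unary.All as Maybe
open import Data.Nat using (ℕ)
open import Function using (_∘_)
open import Relation.Binary.PropositionalEquality
  using (_≡_; _≢_; refl; sym; trans; cong; subst)
open import Relation.Nullary using (Dec; yes; no; does; contradiction)
open import Relation.Nullary.Decidable using (dec-true)

private variable
  A : Set
  k : ℕ

last-++ : (xs ys : List A) → last (xs ++ ys) ≡ last ys <∣> last xs
last-++ []           ys       with last ys
... | just _  = refl
... | nothing = refl
last-++ (x ∷ [])     []       = refl
last-++ (x ∷ [])     (y ∷ ys) = last-∷ y ys
  where
  last-∷ : ∀ y ys {mx : Maybe A} → last (y ∷ ys) ≡ last (y ∷ ys) <∣> mx
  last-∷ y []       = refl
  last-∷ y (z ∷ zs) = last-∷ z zs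
last-++ (_ ∷ x ∷ xs) ys       = last-++ (x ∷ xs) ys

-- Clause and formula evaluation test for `T` first. The later branches give only `F` or `U`, so the
-- value `T` can come from that first test alone.
if-T⁻ : (A? : Dec A) {v : TruthValue} → v ≢ T →
        (if does A? then T else v) ≡ T → A
if-T⁻ (yes a) _   _  = a
if-T⁻ (no _)  v≢T eq = contradiction eq v≢T

if-T⁺ : (A? : Dec A) {v : TruthValue} → A → (if does A? then T else v) ≡ T
if-T⁺ A? a rewrite dec-true A? a = refl

if-F-U≢T : (A? : Dec A) → (if does A? then F else U) ≢ T
if-F-U≢T (yes _) ()
if-F-U≢T (no _)  ()

rightmost-++ : (p : Fin k) (m n : PartialAssignment k) →
               rightmost p (m ++ n) ≡ rightmost p n <∣> rightmost p m
rightmost-++ p m n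
  rewrite map-++ literal m n
        | filter-++ (λ l → atom l ≟ p) (map literal m) (map literal n)
  = last-++ (occurrences m) (occurrences n)
  where
  occurrences = λ m → filter (λ l → atom l ≟ p) (map literal m)

atom-rightmost : (p : Fin k) (m : PartialAssignment k) {l : Literal k} →
                 rightmost p m ≡ just l → atom l ≡ p
atom-rightmost p m eq
  with Maybe.just atom≡p ← subst (Maybe.All _) eq
         (last⁺ (all-filter (λ l → atom l ≟ p) (map literal m)))
  = atom≡p

-- Trades truth for an equation on lookups, so that two literals found by the same lookup can be
-- identified.
evalLiteral-T⁻ : (m : PartialAssignment k) (l : Literal k) →
                 evalLiteral m l ≡ T → rightmost (atom l) m ≡ just l
evalLiteral-T⁻ m l eq with rightmost (atom l) m
... | just l′ = cong just (if-T⁻ (l′ ≟ˡ l) (λ ()) eq)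

evalLiteral-T⁺ : (m : PartialAssignment k) (l : Literal k) →
                 rightmost (atom l) m ≡ just l → evalLiteral m l ≡ T
evalLiteral-T⁺ m l eq rewrite eq = if-T⁺ (l ≟ˡ l) refl

++-satisfiesʳ : (m n : PartialAssignment k) → (m ++ n) Satisfies n
++-satisfiesʳ m n l l∈n = evalLiteral-T⁺ (m ++ n) l
  (trans (rightmost-++ (atom l) m n)
         (cong (_<∣> rightmost (atom l) m) (evalLiteral-T⁻ n l l∈n)))

-- Appending `n` could only harm `l` by overriding its atom. But the overriding literal is true in
-- `n`, hence in `M`, and no assignment makes both literals of an atom true.
++-satisfiesˡ : (M n : PartialAssignment k) → M Satisfies n →
                (M ++ n) Satisfies M
++-satisfiesˡ M n M⊨n l l∈M =
  evalLiteral-T⁺ (M ++ n) l (trans (rightmost-++ (atom l) M n) rightmost≡l)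
  where
  rightmost≡l : rightmost (atom l) n <∣> rightmost (atom l) M ≡ just l
  rightmost≡l with rightmost (atom l) n in eq
  ... | nothing = evalLiteral-T⁻ M l l∈M
  -- Both `l′` and `l` are the rightmost occurrence of the same atom in `M`.
  ... | just l′ = trans (sym l′∈M) (evalLiteral-T⁻ M l l∈M)
    where
    atom≡ : atom l′ ≡ atom l
    atom≡ = atom-rightmost (atom l) n eq

    -- Evaluating `l′` looks up its own atom, while `eq` speaks of `atom l`; hence the transport
    -- along `atom≡`, undone in `l′∈M`.
    l′∈n : evalLiteral n l′ ≡ T
    l′∈n = evalLiteral-T⁺ n l′
      (subst (λ p → rightmost p n ≡ just l′) (sym atom≡) eq)

    l′∈M : rightmost (atom l) M ≡ just l′
    l′∈M = subst (λ p → rightmost p M ≡ just l′) atom≡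
      (evalLiteral-T⁻ M l′ (M⊨n l′ l′∈n))

evalClause-T-mono : (M M′ : PartialAssignment k) → M′ Satisfies M →
                    ∀ c → evalClause M c ≡ T → evalClause M′ c ≡ T
evalClause-T-mono M M′ M′⊨M c eq = if-T⁺ (any? _ c)
  (Any.map (M′⊨M _) (if-T⁻ (any? _ c) (if-F-U≢T (all? _ c)) eq))

-- A clause is true by a true literal, so more true literals cannot spoil a true formula.
model-mono : (M M′ : PartialAssignment k) (f : Formula k) →
             M′ Satisfies M → M IsModelOf f → M′ IsModelOf f
model-mono M M′ f M′⊨M eq = if-T⁺ (all? _ f)
  (All.map (λ {c} → evalClause-T-mono M M′ M′⊨M c)
           (if-T⁻ (all? _ f) (if-F-U≢T (any? _ f)) eq))

++-model : (M n : PartialAssignment k) (f : Formula k) →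
           M Satisfies n → M IsModelOf f → (M ++ n) IsModelOf f
++-model M n f M⊨n = model-mono M (M ++ n) f (++-satisfiesˡ M n M⊨n)

lemma38 : ∀ {k} (m m′ : PartialAssignment k) (f : Formula k) →
    NoDecisions m →
    m′ IsModelOf f →
    f Entails m →
    (m′ ++ m) IsModelOf f
lemma38 m m′ f _ m′⊨f (implied m models⊨m _) =
  ++-model m′ m f (models⊨m m′ m′⊨f) m′⊨f
lemma38 _ m′ f noDec _ (decided m₁ l n _ _ _) =
  contradiction (++⁺ˡ (++⁺ʳ m₁ (here (decision l)))) noDec
-- Once `M` is known to be a model, it satisfies its own suffix `m₁ ∷ʳ propagated l`, so it
-- satisfies the consequences `n`, which may then be appended.
lemma38 _ m′ f noDec m′⊨f (preserved m₁ l n pres models⊨n _ f⊢m₁) =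
  subst (_IsModelOf f) (++-assoc m′ (m₁ ∷ʳ propagated l) n)
    (++-model M n f (models⊨n M M⊨f (++-satisfiesʳ m′ _)) M⊨f)
  where
  M = m′ ++ (m₁ ∷ʳ propagated l)

  M⊨f : M IsModelOf f
  M⊨f = subst (_IsModelOf f) (++-assoc m′ m₁ _)
    -- The induction hypothesis for the decision-free prefix `m₁` gives the model to which `l` is
    -- appended.
    (pres (m′ ++ m₁) (lemma38 m₁ m′ f (noDec ∘ ++⁺ˡ ∘ ++⁺ˡ) m′⊨f f⊢m₁))
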